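{- Let $\Gamma$ be any context of $\lambda\mathsf{HOL}$ (possibly extended by constants and additional conversion rules) in which there are a type $A:\square$ and terms $\mathsf{intro}:T\,A\to A$ and $\mathsf{match}:A\to T\,A$ such that, for every $u:T\,A$, the term $\mathsf{match}\,(\mathsf{intro}\,u)$ is judgementally equal to $u$ (i.e. $T\,A$ is a judgemental retract of $A$). Then there is a term of type $\perp$ in $\Gamma$. In other words, in $\lambda\mathsf{HOL}$ one cannot have a type $A$ such that $\mathsf{Pow}\,(\mathsf{Pow}\,A)$ is a judgemental retract of $A$ without the system becoming inconsistent.
   Context: $\lambda\mathsf{HOL}$ (minimal higher-order logic) is the pure type system with sorts $*,\square,\Delta$, axioms $*:\square$ and $\square:\Delta$, and rules $(*,*)$, $(\square,\square)$, $(\square,*)$; judgemental equality is $\beta$-conversion. Define $\mathsf{Pow}:\square\to\square$ by $\mathsf{Pow}\,X = X\to *$ and $T:\square\to\square$ by $T\,X=\mathsf{Pow}(\mathsf{Pow}\,X)$. Define $\perp:*$ by $\perp=\forall_{p:*}\,p$ and $\neg p = p\to\perp$. -}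

module Defs where

open import Data.Fin.Base using (Fin; zero)
open import Data.Fin.Substitution using (Lift; Sub; TermSubst)
open import Data.List.Base using (List)
open import Data.List.Relation.Unary.All using (All)
open import Data.Nat.Base using (ℕ; zero; suc)
open import Data.Vec.Base using (lookup)

data Sort : Set where
  ∗ □ △ : Sort

data Axiom : Sort → Sort → Set where
  ∗∶□ : Axiom ∗ □
  □∶△ : Axiom □ △

-- A rule (s₁ , s₂) of the pure type system abbreviates (s₁ , s₂ , s₂): the
-- product of a B : s₂ over an A : s₁ has sort s₂.

data ΠRule : Sort → Sort → Set where
  ∗∗ : ΠRule ∗ ∗
  □□ : ΠRule □ □
  □∗ : ΠRule □ ∗

infixl 9 _·_

data Term (C : Set) (n : ℕ) : Set where
  var  : Fin n → Term C n
  con  : C → Term C n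
  sort : Sort → Term C n
  Π    : Term C n → Term C (suc n) → Term C n
  ƛ    : Term C n → Term C (suc n) → Term C n
  _·_  : Term C n → Term C n → Term C n

module TermApp {C : Set} {T : ℕ → Set} (l : Lift T (Term C)) where
  open Lift l hiding (var)

  infixl 8 _/_

  _/_ : ∀ {m n} → Term C m → Sub T m n → Term C n
  var x   / ρ = lift (lookup ρ x)
  con c   / ρ = con c
  sort s  / ρ = sort s
  Π A B   / ρ = Π (A / ρ) (B / ρ ↑)
  ƛ A t   / ρ = ƛ (A / ρ) (t / ρ ↑)
  (t · u) / ρ = (t / ρ) · (u / ρ)

termSubst : (C : Set) → TermSubst (Term C)
termSubst C = record { var = var; app = TermApp._/_ }

weaken : ∀ {C n} → Term C n → Term C (suc n)
weaken {C} = TermSubst.weaken (termSubst C)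

infixl 8 _[_]

_[_] : ∀ {C n} → Term C (suc n) → Term C n → Term C n
_[_] {C} t u = t / sub u
  where open TermSubst (termSubst C)

infixl 5 _▷_

data Ctx (C : Set) : ℕ → Set where
  ε   : Ctx C zero
  _▷_ : ∀ {n} → Ctx C n → Term C n → Ctx C (suc n)

infix 4 _⊢_∶_ _⊢_≈_

data Judgement (C : Set) : Set where
  _⊢_∶_ : ∀ {n} → Ctx C n → Term C n → Term C n → Judgement C
  _⊢_≈_ : ∀ {n} → Ctx C n → Term C n → Term C n → Judgement C

-- Rule ps Γ t u is the additional conversion rule with premises ps and
-- conclusion Γ ⊢ t ≈ u.  A schematic rule is given by all of its instances;
-- premises allow it to be restricted to well-typed ones, as in
-- "match (intro u) ≈ u for u : T A".

record Extension : Set₁ where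
  field
    Const  : Set
    typeOf : Const → Term Const zero
    Rule   : ∀ {n} → List (Judgement Const) →
             Ctx Const n → Term Const n → Term Const n → Set

open Extension public

infix 3 _⊩_

-- Derivability in λHOL extended by E; λHOL itself is the case where Const E
-- and Rule E are empty.  As in Barendregt's presentation of pure type systems,
-- axioms live in the empty context and reach other contexts by weakening, so
-- that Γ ⊢ t ∶ A is derivable only if Γ is well formed, and conversion is a
-- relation on raw terms.  Without additional rules conversion is plain
-- β-conversion: the context is then irrelevant and weak-≈ is admissible.

data _⊩_ (E : Extension) : Judgement (Const E) → Set where

  axiom : ∀ {s₁ s₂} → Axiom s₁ s₂ → E ⊩ ε ⊢ sort s₁ ∶ sort s₂

  const : ∀ {c s} →
          E ⊩ ε ⊢ typeOf E c ∶ sort s →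
          E ⊩ ε ⊢ con c ∶ typeOf E c

  start : ∀ {n} {Γ : Ctx (Const E) n} {A s} →
          E ⊩ Γ ⊢ A ∶ sort s →
          E ⊩ Γ ▷ A ⊢ var zero ∶ weaken A

  weak  : ∀ {n} {Γ : Ctx (Const E) n} {t A B s} →
          E ⊩ Γ ⊢ t ∶ A →
          E ⊩ Γ ⊢ B ∶ sort s →
          E ⊩ Γ ▷ B ⊢ weaken t ∶ weaken A

  prod  : ∀ {n} {Γ : Ctx (Const E) n} {A B s₁ s₂} →
          ΠRule s₁ s₂ →
          E ⊩ Γ ⊢ A ∶ sort s₁ →
          E ⊩ Γ ▷ A ⊢ B ∶ sort s₂ →
          E ⊩ Γ ⊢ Π A B ∶ sort s₂

  app   : ∀ {n} {Γ : Ctx (Const E) n} {t u A B} →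
          E ⊩ Γ ⊢ t ∶ Π A B →
          E ⊩ Γ ⊢ u ∶ A →
          E ⊩ Γ ⊢ t · u ∶ B [ u ]

  abs   : ∀ {n} {Γ : Ctx (Const E) n} {t A B s} →
          E ⊩ Γ ▷ A ⊢ t ∶ B →
          E ⊩ Γ ⊢ Π A B ∶ sort s →
          E ⊩ Γ ⊢ ƛ A t ∶ Π A B

  conv  : ∀ {n} {Γ : Ctx (Const E) n} {t A B s} →
          E ⊩ Γ ⊢ t ∶ A →
          E ⊩ Γ ⊢ B ∶ sort s →
          E ⊩ Γ ⊢ A ≈ B →
          E ⊩ Γ ⊢ t ∶ B

  β      : ∀ {n} {Γ : Ctx (Const E) n} {A t u} →
           E ⊩ Γ ⊢ ƛ A t · u ≈ t [ u ]

  rule   : ∀ {n} {Γ : Ctx (Const E) n} {ps t u} →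
           Rule E ps Γ t u →
           All (E ⊩_) ps →
           E ⊩ Γ ⊢ t ≈ u

  refl-≈ : ∀ {n} {Γ : Ctx (Const E) n} {t} →
           E ⊩ Γ ⊢ t ≈ t

  sym-≈  : ∀ {n} {Γ : Ctx (Const E) n} {t u} →
           E ⊩ Γ ⊢ t ≈ u →
           E ⊩ Γ ⊢ u ≈ t

  trans-≈ : ∀ {n} {Γ : Ctx (Const E) n} {t u v} →
            E ⊩ Γ ⊢ t ≈ u →
            E ⊩ Γ ⊢ u ≈ v →
            E ⊩ Γ ⊢ t ≈ v

  weak-≈ : ∀ {n} {Γ : Ctx (Const E) n} {t u B} →
           E ⊩ Γ ⊢ t ≈ u →
           E ⊩ Γ ▷ B ⊢ weaken t ≈ weaken u

  Π-≈    : ∀ {n} {Γ : Ctx (Const E) n} {A A′ B B′} →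
           E ⊩ Γ ⊢ A ≈ A′ →
           E ⊩ Γ ▷ A ⊢ B ≈ B′ →
           E ⊩ Γ ⊢ Π A B ≈ Π A′ B′

  ƛ-≈    : ∀ {n} {Γ : Ctx (Const E) n} {A A′ t t′} →
           E ⊩ Γ ⊢ A ≈ A′ →
           E ⊩ Γ ▷ A ⊢ t ≈ t′ →
           E ⊩ Γ ⊢ ƛ A t ≈ ƛ A′ t′

  ·-≈    : ∀ {n} {Γ : Ctx (Const E) n} {t t′ u u′} →
           E ⊩ Γ ⊢ t ≈ t′ →
           E ⊩ Γ ⊢ u ≈ u′ →
           E ⊩ Γ ⊢ t · u ≈ t′ · u′

infixr 6 _⇒_

_⇒_ : ∀ {C n} → Term C n → Term C n → Term C n
A ⇒ B = Π A (weaken B)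

-- □ → □ is not a type of λHOL, so Pow and T are operations on terms.

Pow : ∀ {C n} → Term C n → Term C n
Pow X = X ⇒ sort ∗

T : ∀ {C n} → Term C n → Term C n
T X = Pow (Pow X)

⊥ : ∀ {C n} → Term C n
⊥ = Π (sort ∗) (var zero)

{-# OPTIONS --safe #-}

-- With match applied to x : A read as a set of predicates on A, consider
--   P₀ x = ∀ p. match x p → ¬ p x   and   X₀ p = ∀ x. match x p → ¬ p x,
-- and let x₀ = intro X₀, so that match x₀ ≈ X₀.  Instantiating P₀ x at P₀
-- proves X₀ P₀.  Any proof l of match x₀ p is also one of X₀ p, so that l x₀ l
-- proves ¬ p x₀; hence P₀ x₀.  Finally X₀ P₀ at x₀, applied to these two
-- proofs, is a contradiction.  The retraction is used at the single term X₀.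

module Submission where

open import Defs
open import Data.Fin.Base using (zero)
open import Data.Fin.Substitution using (Lift; Sub; Subs; Application; TermSubst)
open import Data.Fin.Substitution.Lemmas using (TermLemmas)
open import Data.Nat.Base using (ℕ; suc)
open import Data.Product.Base using (∃-syntax; _,_)
open import Relation.Binary.Construct.Closure.ReflexiveTransitive using (ε; _◅_)
open import Relation.Binary.PropositionalEquality
  using (_≡_; refl; sym; trans; cong; cong₂)

-- Substitution calculus of raw terms.

module TermAppLemmas {C : Set} {S : ℕ → Set} (l : Lift S (Term C)) where
  open Lift l using (_↑✶_)

  application : Application (Term C) S
  application = record { _/_ = TermApp._/_ l }

  open Application application using (_/✶_)

  -- `/✶` folds over the sequence of substitutions, so a term constructor alone does not make it
  -- reduce; hence one induction on `ρs` per constructor.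
  con-/✶ : ∀ k {m n c} (ρs : Subs S m n) → con c /✶ ρs ↑✶ k ≡ con c
  con-/✶ k ε        = refl
  con-/✶ k (ρ ◅ ρs) = cong₂ (TermApp._/_ l) (con-/✶ k ρs) refl

  sort-/✶ : ∀ k {m n s} (ρs : Subs S m n) → sort s /✶ ρs ↑✶ k ≡ sort s
  sort-/✶ k ε        = refl
  sort-/✶ k (ρ ◅ ρs) = cong₂ (TermApp._/_ l) (sort-/✶ k ρs) refl

  Π-/✶ : ∀ k {m n A B} (ρs : Subs S m n) →
         Π A B /✶ ρs ↑✶ k ≡ Π (A /✶ ρs ↑✶ k) (B /✶ ρs ↑✶ suc k)
  Π-/✶ k ε        = refl
  Π-/✶ k (ρ ◅ ρs) = cong₂ (TermApp._/_ l) (Π-/✶ k ρs) refl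

  ƛ-/✶ : ∀ k {m n A t} (ρs : Subs S m n) →
         ƛ A t /✶ ρs ↑✶ k ≡ ƛ (A /✶ ρs ↑✶ k) (t /✶ ρs ↑✶ suc k)
  ƛ-/✶ k ε        = refl
  ƛ-/✶ k (ρ ◅ ρs) = cong₂ (TermApp._/_ l) (ƛ-/✶ k ρs) refl

  ·-/✶ : ∀ k {m n t u} (ρs : Subs S m n) →
         (t · u) /✶ ρs ↑✶ k ≡ (t /✶ ρs ↑✶ k) · (u /✶ ρs ↑✶ k)
  ·-/✶ k ε        = refl
  ·-/✶ k (ρ ◅ ρs) = cong₂ (TermApp._/_ l) (·-/✶ k ρs) refl

termLemmas : (C : Set) → TermLemmas (Term C)
termLemmas C = record
  { termSubst = termSubst C
  ; app-var   = refl
  ; /✶-↑✶     = Lemma./✶-↑✶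
  }
  where
  module Lemma {S₁ S₂ : ℕ → Set}
               {lift₁ : Lift S₁ (Term C)} {lift₂ : Lift S₂ (Term C)} where
    open TermSubst (termSubst C) using (module Lifted)
    open Lifted lift₁ using () renaming (_↑✶_ to _↑✶₁_; _/✶_ to _/✶₁_)
    open Lifted lift₂ using () renaming (_↑✶_ to _↑✶₂_; _/✶_ to _/✶₂_)
    module L₁ = TermAppLemmas lift₁
    module L₂ = TermAppLemmas lift₂

    -- Induction on the term; quantifying over the number `k` of lifts carries it under binders. As
    -- `S₁` and `S₂` may differ, renamings can be compared with term substitutions.
    /✶-↑✶ : ∀ {m n} (ρs₁ : Subs S₁ m n) (ρs₂ : Subs S₂ m n) →
            (∀ k x → var x /✶₁ ρs₁ ↑✶₁ k ≡ var x /✶₂ ρs₂ ↑✶₂ k) →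
            ∀ k t → t /✶₁ ρs₁ ↑✶₁ k ≡ t /✶₂ ρs₂ ↑✶₂ k
    /✶-↑✶ ρs₁ ρs₂ hyp k (var x)  = hyp k x
    /✶-↑✶ ρs₁ ρs₂ hyp k (con c)  = trans (L₁.con-/✶ k ρs₁) (sym (L₂.con-/✶ k ρs₂))
    /✶-↑✶ ρs₁ ρs₂ hyp k (sort s) = trans (L₁.sort-/✶ k ρs₁) (sym (L₂.sort-/✶ k ρs₂))
    /✶-↑✶ ρs₁ ρs₂ hyp k (Π A B)  = trans (L₁.Π-/✶ k ρs₁)
      (trans (cong₂ Π (/✶-↑✶ ρs₁ ρs₂ hyp k A) (/✶-↑✶ ρs₁ ρs₂ hyp (suc k) B))
             (sym (L₂.Π-/✶ k ρs₂)))
    /✶-↑✶ ρs₁ ρs₂ hyp k (ƛ A t)  = trans (L₁.ƛ-/✶ k ρs₁)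
      (trans (cong₂ ƛ (/✶-↑✶ ρs₁ ρs₂ hyp k A) (/✶-↑✶ ρs₁ ρs₂ hyp (suc k) t))
             (sym (L₂.ƛ-/✶ k ρs₂)))
    /✶-↑✶ ρs₁ ρs₂ hyp k (t · u)  = trans (L₁.·-/✶ k ρs₁)
      (trans (cong₂ _·_ (/✶-↑✶ ρs₁ ρs₂ hyp k t) (/✶-↑✶ ρs₁ ρs₂ hyp k u))
             (sym (L₂.·-/✶ k ρs₂)))

-- The formulas of the paradox under substitution.

module _ {C : Set} where
  open TermLemmas (termLemmas C) using (_/_; _↑; wk; sub; /-wk; weaken-↑; weaken-sub)

  ¬_ : ∀ {n} → Term C n → Term C n
  ¬ a = a ⇒ ⊥

  -- The common matrix of `P₀` and `X₀`, which differ in whether `p` or `x` is quantified.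
  φ : ∀ {n} → Term C n → Term C n → Term C n → Term C n
  φ M x p = M · x · p ⇒ ¬ (p · x)

  ∀p : ∀ {n} → Term C n → Term C n → Term C n → Term C n
  ∀p A M x = Π (Pow A) (φ (weaken M) (weaken x) (var zero))

  ∀x : ∀ {n} → Term C n → Term C n → Term C n → Term C n
  ∀x A M p = Π A (φ (weaken M) (var zero) (weaken p))

  P₀ : ∀ {n} → Term C n → Term C n → Term C n
  P₀ A M = ƛ A (∀p (weaken A) (weaken M) (var zero))

  X₀ : ∀ {n} → Term C n → Term C n → Term C n
  X₀ A M = ƛ (Pow A) (∀x (weaken A) (weaken M) (var zero))

  cong₃ : ∀ {i j k l} (f : Term C i → Term C j → Term C k → Term C l)
          {x x′ y y′ z z′} → x ≡ x′ → y ≡ y′ → z ≡ z′ → f x y z ≡ f x′ y′ z′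
  cong₃ f refl refl refl = refl

  module _ {m n : ℕ} (ρ : Sub (Term C) m n) where

    ⇒-/ : ∀ A B → (A ⇒ B) / ρ ≡ (A / ρ) ⇒ (B / ρ)
    ⇒-/ A B = cong (Π _) (weaken-↑ B)

    Pow-/ : ∀ A → Pow A / ρ ≡ Pow (A / ρ)
    Pow-/ A = ⇒-/ A (sort ∗)

    T-/ : ∀ A → T A / ρ ≡ T (A / ρ)
    T-/ A = trans (Pow-/ (Pow A)) (cong Pow (Pow-/ A))

    φ-/ : ∀ M x p → φ M x p / ρ ≡ φ (M / ρ) (x / ρ) (p / ρ)
    φ-/ M x p = trans (⇒-/ (M · x · p) (¬ (p · x)))
                      (cong ((M · x · p) / ρ ⇒_) (⇒-/ (p · x) ⊥))

  -- A fresh module, because the lemmas about a fixed `ρ` are now needed at `ρ ↑`, under a binder.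
  module _ {m n : ℕ} (ρ : Sub (Term C) m n) where

    ∀p-/ : ∀ A M x → ∀p A M x / ρ ≡ ∀p (A / ρ) (M / ρ) (x / ρ)
    ∀p-/ A M x = cong₂ Π (Pow-/ ρ A)
      (trans (φ-/ (ρ ↑) (weaken M) (weaken x) (var zero))
             (cong₃ φ (weaken-↑ M) (weaken-↑ x) (refl {x = var zero})))

    ∀x-/ : ∀ A M p → ∀x A M p / ρ ≡ ∀x (A / ρ) (M / ρ) (p / ρ)
    ∀x-/ A M p = cong (Π _)
      (trans (φ-/ (ρ ↑) (weaken M) (var zero) (weaken p))
             (cong₃ φ (weaken-↑ M) (refl {x = var zero}) (weaken-↑ p)))

  module _ {m n : ℕ} (ρ : Sub (Term C) m n) where

    P₀-/ : ∀ A M → P₀ A M / ρ ≡ P₀ (A / ρ) (M / ρ)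
    P₀-/ A M = cong (ƛ _)
      (trans (∀p-/ (ρ ↑) (weaken A) (weaken M) (var zero))
             (cong₃ ∀p (weaken-↑ A) (weaken-↑ M) (refl {x = var zero})))

    X₀-/ : ∀ A M → X₀ A M / ρ ≡ X₀ (A / ρ) (M / ρ)
    X₀-/ A M = cong₂ ƛ (Pow-/ ρ A)
      (trans (∀x-/ (ρ ↑) (weaken A) (weaken M) (var zero))
             (cong₃ ∀x (weaken-↑ A) (weaken-↑ M) (refl {x = var zero})))

  module _ {n : ℕ} where

    -- `weaken` is a renaming while `wk` substitutes terms; `/-wk` transfers the substitution lemmas
    -- from one to the other.
    weaken₁ : (F : ∀ {n} → Term C n → Term C n) →
              (∀ A → F A / wk {n} ≡ F (A / wk)) →
              ∀ A → weaken (F A) ≡ F (weaken A)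
    weaken₁ F F-/ A = trans (sym (/-wk {t = F A})) (trans (F-/ A) (cong F (/-wk {t = A})))

    weaken₂ : (F : ∀ {n} → Term C n → Term C n → Term C n) →
              (∀ A B → F A B / wk {n} ≡ F (A / wk) (B / wk)) →
              ∀ A B → weaken (F A B) ≡ F (weaken A) (weaken B)
    weaken₂ F F-/ A B = trans (sym (/-wk {t = F A B}))
      (trans (F-/ A B) (cong₂ F (/-wk {t = A}) (/-wk {t = B})))

    Pow-weaken : ∀ (A : Term C n) → weaken (Pow A) ≡ Pow (weaken A)
    Pow-weaken = weaken₁ Pow (Pow-/ wk)

    A⇒TA-weaken : ∀ (A : Term C n) → weaken (A ⇒ T A) ≡ weaken A ⇒ T (weaken A)
    A⇒TA-weaken = weaken₁ (λ A → A ⇒ T A)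
      (λ A → trans (⇒-/ wk A (T A)) (cong (A / wk ⇒_) (T-/ wk A)))

    P₀-weaken : ∀ (A M : Term C n) → weaken (P₀ A M) ≡ P₀ (weaken A) (weaken M)
    P₀-weaken = weaken₂ P₀ (P₀-/ wk)

    X₀-weaken : ∀ (A M : Term C n) → weaken (X₀ A M) ≡ X₀ (weaken A) (weaken M)
    X₀-weaken = weaken₂ X₀ (X₀-/ wk)

    φ-[p] : ∀ (M x u : Term C n) → φ (weaken M) (weaken x) (var zero) [ u ] ≡ φ M x u
    φ-[p] M x u = trans (φ-/ (sub u) (weaken M) (weaken x) (var zero))
                        (cong₃ φ (weaken-sub M) (weaken-sub x) (refl {x = u}))

    φ-[x] : ∀ (M p u : Term C n) → φ (weaken M) (var zero) (weaken p) [ u ] ≡ φ M u p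
    φ-[x] M p u = trans (φ-/ (sub u) (weaken M) (var zero) (weaken p))
                        (cong₃ φ (weaken-sub M) (refl {x = u}) (weaken-sub p))

    ∀p-[] : ∀ (A M u : Term C n) → ∀p (weaken A) (weaken M) (var zero) [ u ] ≡ ∀p A M u
    ∀p-[] A M u = trans (∀p-/ (sub u) (weaken A) (weaken M) (var zero))
                        (cong₃ ∀p (weaken-sub A) (weaken-sub M) (refl {x = u}))

    ∀x-[] : ∀ (A M u : Term C n) → ∀x (weaken A) (weaken M) (var zero) [ u ] ≡ ∀x A M u
    ∀x-[] A M u = trans (∀x-/ (sub u) (weaken A) (weaken M) (var zero))
                        (cong₃ ∀x (weaken-sub A) (weaken-sub M) (refl {x = u}))

-- Typing and provability in an extension.

module _ {E : Extension} where
  open TermLemmas (termLemmas (Const E)) using (weaken-sub)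

  private variable
    n : ℕ
    Γ : Ctx (Const E) n
    s : Sort
    a b t u A B M x p : Term (Const E) n

  ∶-resp-≡ : A ≡ B → E ⊩ Γ ⊢ t ∶ A → E ⊩ Γ ⊢ t ∶ B
  ∶-resp-≡ refl d = d

  ≈-reflexive : t ≡ u → E ⊩ Γ ⊢ t ≈ u
  ≈-reflexive refl = refl-≈

  -- Axioms live in the empty context, so `∗ : □` has to be weakened up to `Γ`. The `start` and
  -- `weak` steps of any derivation over `Γ` supply the type formations that this requires.
  ∗∶□-valid : E ⊩ Γ ⊢ t ∶ A → E ⊩ Γ ⊢ sort ∗ ∶ sort □
  ∗∶□-valid (axiom _)    = axiom ∗∶□
  ∗∶□-valid (const d)    = ∗∶□-valid d
  ∗∶□-valid (start d)    = weak (∗∶□-valid d) d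
  ∗∶□-valid (weak d e)   = weak (∗∶□-valid d) e
  ∗∶□-valid (prod _ d _) = ∗∶□-valid d
  ∗∶□-valid (app d _)    = ∗∶□-valid d
  ∗∶□-valid (abs _ d)    = ∗∶□-valid d
  ∗∶□-valid (conv d _ _) = ∗∶□-valid d

  ⇒-elim : E ⊩ Γ ⊢ t ∶ A ⇒ B → E ⊩ Γ ⊢ u ∶ A → E ⊩ Γ ⊢ t · u ∶ B
  ⇒-elim {B = B} d e = ∶-resp-≡ (weaken-sub B) (app d e)

  ⇒∶∗ : E ⊩ Γ ⊢ a ∶ sort ∗ → E ⊩ Γ ⊢ b ∶ sort ∗ → E ⊩ Γ ⊢ a ⇒ b ∶ sort ∗
  ⇒∶∗ d e = prod ∗∗ d (weak e d)

  ⊥∶∗ : E ⊩ Γ ⊢ t ∶ A → E ⊩ Γ ⊢ ⊥ ∶ sort ∗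
  ⊥∶∗ d = prod □∗ (∗∶□-valid d) (start (∗∶□-valid d))

  Pow∶□ : E ⊩ Γ ⊢ A ∶ sort □ → E ⊩ Γ ⊢ Pow A ∶ sort □
  Pow∶□ d = prod □□ d (weak (∗∶□-valid d) d)

  -- Only inhabitation of propositions matters to the argument, so proof terms are hidden and never
  -- written out.
  Provable : Ctx (Const E) n → Term (Const E) n → Set
  Provable Γ a = ∃[ t ] E ⊩ Γ ⊢ t ∶ a

  Π-intro : Provable (Γ ▷ A) B → E ⊩ Γ ⊢ Π A B ∶ sort s → Provable Γ (Π A B)
  Π-intro (_ , d) ΠAB∶s = _ , abs d ΠAB∶s

  Provable-resp-≡ : a ≡ b → Provable Γ a → Provable Γ b
  Provable-resp-≡ refl d = d

  mp : Provable Γ (a ⇒ b) → Provable Γ a → Provable Γ b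
  mp (_ , d) (_ , e) = _ , ⇒-elim d e

  convert : E ⊩ Γ ⊢ b ∶ sort ∗ → E ⊩ Γ ⊢ a ≈ b → Provable Γ a → Provable Γ b
  convert b∶∗ eq (_ , d) = _ , conv d b∶∗ eq

  ⇒¬-intro : E ⊩ Γ ⊢ a ∶ sort ∗ → E ⊩ Γ ⊢ b ∶ sort ∗ →
             Provable (Γ ▷ a ▷ weaken b) ⊥ → Provable Γ (a ⇒ ¬ b)
  ⇒¬-intro {Γ = Γ} {a = a} {b = b} a∶∗ b∶∗ (_ , d) =
    _ , abs (abs {A = weaken b} {B = ⊥} d (⇒∶∗ b′∶∗ (⊥∶∗ b′∶∗)))
            (⇒∶∗ a∶∗ (⇒∶∗ b∶∗ (⊥∶∗ b∶∗)))
    where b′∶∗ = weak b∶∗ a∶∗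

  φ-elim : Provable Γ (φ M x p) → Provable Γ (M · x · p) → Provable Γ (p · x) →
           Provable Γ ⊥
  φ-elim f h k = mp (mp f h) k

  weak-code : E ⊩ Γ ⊢ M · x ≈ X₀ A M →
              E ⊩ Γ ▷ B ⊢ weaken M · weaken x ≈ X₀ (weaken A) (weaken M)
  weak-code {M = M} {A = A} eq = trans-≈ (weak-≈ eq) (≈-reflexive (X₀-weaken A M))

  -- `M` is the structure map of a coalgebra for `T`. Unlike a retraction quantified over terms of
  -- `Γ`, these two typings pass to extended contexts.
  record Coalgebra (Γ : Ctx (Const E) n) (A M : Term (Const E) n) : Set where
    field
      A∶□    : E ⊩ Γ ⊢ A ∶ sort □
      M∶A⇒TA : E ⊩ Γ ⊢ M ∶ A ⇒ T A

  open Coalgebra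

  weak-coalgebra : Coalgebra Γ A M → E ⊩ Γ ⊢ B ∶ sort s →
                   Coalgebra (Γ ▷ B) (weaken A) (weaken M)
  weak-coalgebra {A = A} c d = record
    { A∶□    = weak (A∶□ c) d
    ; M∶A⇒TA = ∶-resp-≡ (A⇒TA-weaken A) (weak (M∶A⇒TA c) d)
    }

  module _ {n : ℕ} {Γ : Ctx (Const E) n} {A M : Term (Const E) n} (c : Coalgebra Γ A M) where

    Mxp∶∗ : E ⊩ Γ ⊢ x ∶ A → E ⊩ Γ ⊢ p ∶ Pow A → E ⊩ Γ ⊢ M · x · p ∶ sort ∗
    Mxp∶∗ x∶A p∶PA = ⇒-elim (⇒-elim (M∶A⇒TA c) x∶A) p∶PA

    φ∶∗ : E ⊩ Γ ⊢ x ∶ A → E ⊩ Γ ⊢ p ∶ Pow A → E ⊩ Γ ⊢ φ M x p ∶ sort ∗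
    φ∶∗ x∶A p∶PA = ⇒∶∗ (Mxp∶∗ x∶A p∶PA) (⇒∶∗ (⇒-elim p∶PA x∶A) (⊥∶∗ x∶A))

    var∶Pow : E ⊩ Γ ▷ Pow A ⊢ var zero ∶ Pow (weaken A)
    var∶Pow = ∶-resp-≡ (Pow-weaken A) (start (Pow∶□ (A∶□ c)))

  module _ {n : ℕ} {Γ : Ctx (Const E) n} {A M : Term (Const E) n} (c : Coalgebra Γ A M) where

    ∀p∶∗ : E ⊩ Γ ⊢ x ∶ A → E ⊩ Γ ⊢ ∀p A M x ∶ sort ∗
    ∀p∶∗ x∶A = prod □∗ PA∶□ (φ∶∗ (weak-coalgebra c PA∶□) (weak x∶A PA∶□) (var∶Pow c))
      where PA∶□ = Pow∶□ (A∶□ c)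

    ∀x∶∗ : E ⊩ Γ ⊢ p ∶ Pow A → E ⊩ Γ ⊢ ∀x A M p ∶ sort ∗
    ∀x∶∗ p∶PA = prod □∗ (A∶□ c)
      (φ∶∗ (weak-coalgebra c (A∶□ c)) (start (A∶□ c))
           (∶-resp-≡ (Pow-weaken A) (weak p∶PA (A∶□ c))))

    ∀p-elim : Provable Γ (∀p A M x) → E ⊩ Γ ⊢ p ∶ Pow A → Provable Γ (φ M x p)
    ∀p-elim {x = x} {p = p} (_ , d) p∶PA = _ , ∶-resp-≡ (φ-[p] M x p) (app d p∶PA)

    ∀x-elim : Provable Γ (∀x A M p) → E ⊩ Γ ⊢ x ∶ A → Provable Γ (φ M x p)
    ∀x-elim {p = p} {x = x} (_ , d) x∶A = _ , ∶-resp-≡ (φ-[x] M p x) (app d x∶A)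

  -- The paradox.

  module _ {n : ℕ} {Γ : Ctx (Const E) n} {A M : Term (Const E) n} (c : Coalgebra Γ A M) where

    P₀∶Pow : E ⊩ Γ ⊢ P₀ A M ∶ Pow A
    P₀∶Pow = abs (∀p∶∗ (weak-coalgebra c (A∶□ c)) (start (A∶□ c))) (Pow∶□ (A∶□ c))

    X₀∶T : E ⊩ Γ ⊢ X₀ A M ∶ T A
    X₀∶T = abs (∀x∶∗ (weak-coalgebra c PA∶□) (var∶Pow c)) (Pow∶□ PA∶□)
      where PA∶□ = Pow∶□ (A∶□ c)

    P₀-β : E ⊩ Γ ⊢ P₀ A M · x ≈ ∀p A M x
    P₀-β {x = x} = trans-≈ β (≈-reflexive (∀p-[] A M x))

    X₀-β : E ⊩ Γ ⊢ X₀ A M · p ≈ ∀x A M p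
    X₀-β {p = p} = trans-≈ β (≈-reflexive (∀x-[] A M p))

    -- `k` is used twice: unfolded by β and instantiated at `P₀ A M` itself, it refutes `h` together
    -- with `k`.
    P₀-contradiction : E ⊩ Γ ⊢ x ∶ A → Provable Γ (M · x · P₀ A M) →
                       Provable Γ (P₀ A M · x) → Provable Γ ⊥
    P₀-contradiction {x = x} x∶A h k =
      φ-elim (∀p-elim c {x = x} (convert (∀p∶∗ c x∶A) (P₀-β {x = x}) k) P₀∶Pow) h k

    -- intro X₀ enters only through this equation, which, unlike the
    -- retraction hypothesis, is stable under weakening.
    x₀-contradiction : E ⊩ Γ ⊢ x ∶ A → E ⊩ Γ ⊢ M · x ≈ X₀ A M → E ⊩ Γ ⊢ p ∶ Pow A →
                       Provable Γ (M · x · p) → Provable Γ (p · x) → Provable Γ ⊥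
    x₀-contradiction {p = p} x∶A eq p∶PA h k =
      -- `h` also plays two roles: converted to `h′` it is instantiated at `x`, and unconverted it
      -- is the premise of that instance.
      φ-elim (∀x-elim c {p = p} h′ x∶A) h k
      where h′ = convert (∀x∶∗ c p∶PA) (trans-≈ (·-≈ eq refl-≈) (X₀-β {p = p})) h

  module _ {n : ℕ} {Γ : Ctx (Const E) n} {A M : Term (Const E) n} (c : Coalgebra Γ A M) where

    φ-P₀ : E ⊩ Γ ⊢ x ∶ A → Provable Γ (φ M x (P₀ A M))
    φ-P₀ {x = x} x∶A = ⇒¬-intro h∶∗ k∶∗
      (P₀-contradiction (weak-coalgebra (weak-coalgebra c h∶∗) k′∶∗)
        (weak (weak x∶A h∶∗) k′∶∗)
        -- The assumptions mention the weakened `P₀ A M`, which equals `P₀` of the weakened data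
        -- only propositionally.
        (_ , ∶-resp-≡ (cong (weaken (weaken (M · x)) ·_) weaken²-P₀) (weak (start h∶∗) k′∶∗))
        (_ , ∶-resp-≡ (cong (_· weaken (weaken x)) weaken²-P₀) (start k′∶∗)))
      where
      h∶∗  = Mxp∶∗ c x∶A (P₀∶Pow c)
      k∶∗  = ⇒-elim (P₀∶Pow c) x∶A
      k′∶∗ = weak k∶∗ h∶∗
      weaken²-P₀ : weaken (weaken (P₀ A M)) ≡ P₀ (weaken (weaken A)) (weaken (weaken M))
      weaken²-P₀ = trans (cong weaken (P₀-weaken A M)) (P₀-weaken (weaken A) (weaken M))

  module _ {n : ℕ} {Γ : Ctx (Const E) n} {A M : Term (Const E) n} (c : Coalgebra Γ A M) where

    -- Dual to `φ-P₀`: there the predicate is `P₀` and the point arbitrary, here the point codes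
    -- `X₀` and the predicate is arbitrary. Generalising the former gives `X₀-P₀`, the latter
    -- `P₀-x₀`.
    φ-x₀ : E ⊩ Γ ⊢ x ∶ A → E ⊩ Γ ⊢ M · x ≈ X₀ A M → E ⊩ Γ ⊢ p ∶ Pow A →
           Provable Γ (φ M x p)
    φ-x₀ {x = x} {p = p} x∶A eq p∶PA = ⇒¬-intro h∶∗ k∶∗
      (x₀-contradiction c₂ {x = weaken (weaken x)} {p = weaken (weaken p)}
        (weak (weak x∶A h∶∗) k′∶∗)
        (weak-code {M = weaken M} {x = weaken x} (weak-code {M = M} {x = x} eq))
        (∶-resp-≡ (trans (cong weaken (Pow-weaken A)) (Pow-weaken (weaken A)))
                  (weak (weak p∶PA h∶∗) k′∶∗))
        (_ , weak (start h∶∗) k′∶∗)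
        (_ , start k′∶∗))
      where
      h∶∗  = Mxp∶∗ c x∶A p∶PA
      k∶∗  = ⇒-elim p∶PA x∶A
      k′∶∗ = weak k∶∗ h∶∗
      c₁   = weak-coalgebra c h∶∗
      c₂   = weak-coalgebra c₁ k′∶∗

    X₀-P₀ : Provable Γ (∀x A M (P₀ A M))
    X₀-P₀ = Π-intro
      (Provable-resp-≡ (cong (φ (weaken M) (var zero)) (sym (P₀-weaken A M)))
        (φ-P₀ (weak-coalgebra c (A∶□ c)) {x = var zero} (start (A∶□ c))))
      (∀x∶∗ c (P₀∶Pow c))

  module _ {n : ℕ} {Γ : Ctx (Const E) n} {A M : Term (Const E) n} (c : Coalgebra Γ A M) where

    P₀-x₀ : E ⊩ Γ ⊢ x ∶ A → E ⊩ Γ ⊢ M · x ≈ X₀ A M → Provable Γ (∀p A M x)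
    P₀-x₀ {x = x} x∶A eq = Π-intro
      (φ-x₀ (weak-coalgebra c PA∶□) {x = weaken x} {p = var zero}
            (weak x∶A PA∶□) (weak-code {M = M} {x = x} eq) (var∶Pow c))
      (∀p∶∗ c x∶A)
      where PA∶□ = Pow∶□ (A∶□ c)

    code⇒⊥ : E ⊩ Γ ⊢ x ∶ A → E ⊩ Γ ⊢ M · x ≈ X₀ A M → Provable Γ ⊥
    code⇒⊥ {x = x} x∶A eq = P₀-contradiction c {x = x} x∶A
      -- Conversion run backwards: from the β-reduct of `X₀ A M · P₀ A M` to `M · x · P₀ A M`,
      -- through the code equation.
      (convert (Mxp∶∗ c x∶A (P₀∶Pow c))
               (sym-≈ (trans-≈ (·-≈ eq refl-≈) (X₀-β c {p = P₀ A M}))) (X₀-P₀ c))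
      (convert (⇒-elim (P₀∶Pow c) x∶A) (sym-≈ (P₀-β c {x = x})) (P₀-x₀ x∶A eq))

theorem1 : (E : Extension) {n : ℕ} (Γ : Ctx (Const E) n) (A intro match : Term (Const E) n) →
    E ⊩ Γ ⊢ A ∶ sort □ →
    E ⊩ Γ ⊢ intro ∶ T A ⇒ A →
    E ⊩ Γ ⊢ match ∶ A ⇒ T A →
    (∀ u → E ⊩ Γ ⊢ u ∶ T A → E ⊩ Γ ⊢ match · (intro · u) ≈ u) →
    ∃[ t ] E ⊩ Γ ⊢ t ∶ ⊥
theorem1 E Γ A intro match A∶□ intro∶ match∶ retract =
  -- The point is `intro · X₀ A match`, and `retract` makes it a code of `X₀`.
  code⇒⊥ c (⇒-elim intro∶ (X₀∶T c)) (retract (X₀ A match) (X₀∶T c))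
  where
  c : Coalgebra Γ A match
  c = record { A∶□ = A∶□ ; M∶A⇒TA = match∶ }
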